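{- Let $k\geq 3$ and $n\ge 1$. There is a bijection $f$ from the set $\mathcal{S}_n(G_k)$ of permutations of $[n]$ avoiding $G_k=1\,2\,\cdots\,(k-2)\,k\,(k-1)$ to the set $\mathcal{S}_n(H_k,Q_k)$ of permutations of $[n]$ avoiding both $H_k$ and $Q_k$, such that $\mathcal{D}(f(\pi))=\mathcal{D}(\pi)$ for every $\pi\in\mathcal{S}_n(G_k)$.
   Context: For $\pi=\pi_1\cdots\pi_n$ a permutation of $[n]$, $\mathcal{D}(\pi)=\{i:\pi_i>\pi_{i+1}\}$ is its descent set. A subsequence $\pi_{i_1}\cdots\pi_{i_k}$ ($i_1<\cdots<i_k$) is order-isomorphic to a pattern $\tau$ if its entries appear in the same relative order as $\tau$; $\pi$ avoids $\tau$ if no such subsequence exists. Let $J_k=12\cdots k$ and $G_k=1\,2\cdots(k-2)\,k\,(k-1)$. We say $\pi$ contains an occurrence of $H_k$ if there exist indices $i_1<\cdots<i_k$ such that $\pi_{i_1}\cdots\pi_{i_k}$ is order-isomorphic to $J_k$ and there exists $j\in\mathcal{D}(\pi)$ with $i_{k-1}\le j<i_k$; otherwise $\pi$ avoids $H_k$. We say $\pi$ contains an occurrence of $Q_k$ if there exist indices $i_1<\cdots<i_k$ such that $\pi_{i_1}\cdots\pi_{i_k}$ is order-isomorphic to $G_k$ and $\pi_{i_{k-1}}<\pi_{i_{k-1}+1}<\cdots<\pi_{i_k-1}>\pi_{i_k}$; otherwise $\pi$ avoids $Q_k$. $\mathcal{S}_n(H_k,Q_k)$ is the set of permutations of $[n]$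 avoiding both $H_k$ and $Q_k$. -}

module Defs where

open import Data.Nat using (ℕ; zero; suc; _≤_; _<_; _∸_; _≟_)
open import Data.Fin using (Fin; toℕ)
open import Data.Fin.Permutation using (Permutation′; _⟨$⟩ʳ_)
open import Data.Product using (Σ; ∃; ∃-syntax; _×_; _,_)
open import Relation.Binary.PropositionalEquality using (_≡_)
open import Relation.Nullary using (¬_; yes; no)
open import Function.Bundles using (_⇔_)

-- Conventions: positions are 0-based (Fin n), values π(p) are read as
-- natural numbers via toℕ (0-based values; only relative order matters).

val : ∀ {n} → Permutation′ n → Fin n → ℕ
val π p = toℕ (π ⟨$⟩ʳ p)

-- Descent set (0-based): j ∈ D(π) iff π_j > π_{j+1}.
-- (The 1-based descent set is the shift by one; equality of descent sets
-- is unaffected.)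
Descent : ∀ {n} → Permutation′ n → ℕ → Set
Descent {n} π j = Σ (Fin n) λ p → Σ (Fin n) λ q →
  toℕ p ≡ j × toℕ q ≡ suc j × val π q < val π p

J : (k : ℕ) → Fin k → ℕ
J k a = toℕ a

G : (k : ℕ) → Fin k → ℕ
G k a with toℕ a ≟ k ∸ 2
... | yes _ = k ∸ 1
... | no _ with toℕ a ≟ k ∸ 1
...   | yes _ = k ∸ 2
...   | no _ = toℕ a

StrictlyIncreasing : ∀ {k n} → (Fin k → Fin n) → Set
StrictlyIncreasing {k} ι = ∀ (a b : Fin k) → toℕ a < toℕ b → toℕ (ι a) < toℕ (ι b)

OrderIso : ∀ {k n} → Permutation′ n → (Fin k → Fin n) → (Fin k → ℕ) → Set
OrderIso π ι τ = ∀ a b → (τ a < τ b) ⇔ (val π (ι a) < val π (ι b))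

Occurrence : ∀ {k n} → Permutation′ n → (Fin k → ℕ) → (Fin k → Fin n) → Set
Occurrence π τ ι = StrictlyIncreasing ι × OrderIso π ι τ

ContainsPattern : ∀ {k n} → Permutation′ n → (Fin k → ℕ) → Set
ContainsPattern {k} {n} π τ = Σ (Fin k → Fin n) λ ι → Occurrence π τ ι

Avoids : ∀ {k n} → Permutation′ n → (Fin k → ℕ) → Set
Avoids π τ = ¬ ContainsPattern π τ

-- π contains H_k: an occurrence ι of J_k with a descent j such that
-- i_{k-1} ≤ j < i_k  (0-based: ι(k-2) ≤ j < ι(k-1)).
ContainsH : ∀ {n} → (k : ℕ) → Permutation′ n → Set
ContainsH {n} k π = Σ (Fin k → Fin n) λ ι → Occurrence π (J k) ι ×
  Σ (Fin k) λ a → Σ (Fin k) λ b → toℕ a ≡ k ∸ 2 × toℕ b ≡ k ∸ 1 ×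
  ∃[ j ] (Descent π j × toℕ (ι a) ≤ j × j < toℕ (ι b))

-- π contains Q_k: an occurrence ι of G_k with
-- π_{i_{k-1}} < π_{i_{k-1}+1} < ... < π_{i_k - 1} > π_{i_k}.
ContainsQ : ∀ {n} → (k : ℕ) → Permutation′ n → Set
ContainsQ {n} k π = Σ (Fin k → Fin n) λ ι → Occurrence π (G k) ι ×
  Σ (Fin k) λ a → Σ (Fin k) λ b → toℕ a ≡ k ∸ 2 × toℕ b ≡ k ∸ 1 ×
  ((∀ (p q : Fin n) → toℕ (ι a) ≤ toℕ p → toℕ q ≡ suc (toℕ p) →
      toℕ q < toℕ (ι b) → val π p < val π q)
   × (∀ (p : Fin n) → toℕ (ι b) ≡ suc (toℕ p) → val π (ι b) < val π p))

AvoidsG : ∀ {n} → (k : ℕ) → Permutation′ n → Set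
AvoidsG k π = Avoids π (G k)

AvoidsHQ : ∀ {n} → (k : ℕ) → Permutation′ n → Set
AvoidsHQ k π = ¬ ContainsH k π × ¬ ContainsQ k π

_≈ₚ_ : ∀ {n} → Permutation′ n → Permutation′ n → Set
_≈ₚ_ {n} π σ = ∀ (p : Fin n) → π ⟨$⟩ʳ p ≡ σ ⟨$⟩ʳ p

-- f : S_n(G_k) → S_n(H_k,Q_k) is a bijection preserving descent sets.
-- The domain is the subtype of G_k-avoiders (proof-irrelevant in the
-- sense that f must respect ≈ₚ regardless of the avoidance proofs).
DescentPreservingBijection : (k n : ℕ) →
  ((π : Permutation′ n) → AvoidsG k π → Permutation′ n) → Set
DescentPreservingBijection k n f =
  (∀ π σ (a : AvoidsG k π) (b : AvoidsG k σ) → π ≈ₚ σ → f π a ≈ₚ f σ b)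
  × (∀ π (a : AvoidsG k π) → AvoidsHQ k (f π a))
  × (∀ π σ (a : AvoidsG k π) (b : AvoidsG k σ) → f π a ≈ₚ f σ b → π ≈ₚ σ)
  × (∀ σ → AvoidsHQ k σ → Σ (Permutation′ n) λ π → Σ (AvoidsG k π) λ a → f π a ≈ₚ σ)
  × (∀ π (a : AvoidsG k π) (j : ℕ) → Descent (f π a) j ⇔ Descent π j)

{-# OPTIONS --safe #-}
module Submission where

-- Put m = k − 2 and call an entry big if it is the top of an increasing subsequence of length m + 1,
-- small otherwise. Which cells have an increasing subsequence of length m below and to their left
-- depends only on the small entries, so the big entries may be permuted as long as each one still
-- lands in such a cell. For an injective weight w on positions, call a filling sorted if no exchange
-- of two big entries that moves a larger value to a larger weight is allowed. Such exchanges
-- increase Σ w(p) π(p), so sorted fillings exist, and they are unique given the small entries.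
-- Avoiding G_k is being sorted for w(p) = p; avoiding H_k and Q_k is being sorted for a weight that
-- makes the big entries increase within each run of consecutive positions and decrease from run to
-- run. In both cases the descents are determined by the small entries: big entries ascend
-- within a run, and one always ascends from a small entry to an adjacent big one and descends back.

open import Defs
open import Algebra.Properties.Monoid.Sum using (sum; sum-cong-≗)
open import Data.Empty using (⊥)
open import Data.Fin using (Fin; zero; suc; toℕ; fromℕ<)
open import Data.Fin.Permutation
  using (Permutation′; _⟨$⟩ʳ_; _⟨$⟩ˡ_; inverseʳ; transpose; _∘ₚ_)
open import Data.Fin.Properties using (any?; toℕ-injective; toℕ<n; toℕ-fromℕ<; nonZeroIndex)
  renaming (_≟_ to _≟ᶠ_)
open import Data.Nat
open import Data.Nat.Induction using (<-wellFounded)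
open import Data.Nat.DivMod using (_%_; [m+kn]%n≡m%n; m<n⇒m%n≡m)
open import Data.Nat.Properties
open import Data.Nat.Tactic.RingSolver using (solve-∀)
open import Data.Product using (Σ; ∃-syntax; _×_; _,_; proj₁; proj₂)
open import Data.Sum using (_⊎_; inj₁; inj₂; reduce)
open import Data.Unit using (⊤; tt)
open import Data.Vec.Functional using (updateAt)
open import Data.Vec.Functional.Properties using (updateAt-updates; updateAt-minimal)
open import Function using (_∘_)
open import Function.Bundles using (_⇔_; mk⇔; Equivalence; Injection)
open import Function.Construct.Composition using (_⇔-∘_)
open import Function.Construct.Symmetry using (⇔-sym)
open import Function.Definitions using (Injective)
open import Function.Properties.Inverse using (↔⇒↣)
open import Induction.WellFounded using (Acc; acc)
open import Relation.Binary.Definitions using (tri<; tri≈; tri>)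
open import Relation.Binary.PropositionalEquality hiding (J)
open import Relation.Nullary using (¬_; Dec; yes; no; contradiction)
open import Relation.Nullary.Decidable using (_×-dec_; dec-true; dec-false)

open Equivalence using (to; from)

-- Finite sums and the rearrangement inequality.

∑ : ∀ {n} → (Fin n → ℕ) → ℕ
∑ = sum +-0-monoid

∑-mono : ∀ {n} {f g : Fin n → ℕ} → (∀ i → f i ≤ g i) → ∑ f ≤ ∑ g
∑-mono {zero} f≤g = z≤n
∑-mono {suc n} f≤g = +-mono-≤ (f≤g zero) (∑-mono (f≤g ∘ suc))

∑-mono-< : ∀ {n} {f g : Fin n → ℕ} → (∀ i → f i ≤ g i) → ∀ j → f j < g j → ∑ f < ∑ g
∑-mono-< f≤g zero fj<gj = +-mono-<-≤ fj<gj (∑-mono (f≤g ∘ suc))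
∑-mono-< f≤g (suc j) fj<gj = +-mono-≤-< (f≤g zero) (∑-mono-< (f≤g ∘ suc) j fj<gj)

-- Subtraction-free form of ∑ f - ∑ g = f p - g p.
∑-agree-off : ∀ {n} (f g : Fin n → ℕ) p → (∀ i → i ≢ p → f i ≡ g i) →
  ∑ f + g p ≡ ∑ g + f p
∑-agree-off f g zero f≗g = trans (cong (λ s → f zero + s + g zero)
    (sum-cong-≗ +-0-monoid (λ i → f≗g (suc i) λ ()))) (exchange (f zero) _ (g zero))
  where
  exchange : ∀ a s b → a + s + b ≡ b + s + a
  exchange = solve-∀
∑-agree-off f g (suc p) f≗g = begin
  f zero + ∑ (f ∘ suc) + g (suc p)    ≡⟨ +-assoc (f zero) _ _ ⟩
  f zero + (∑ (f ∘ suc) + g (suc p))  ≡⟨ cong₂ _+_ (f≗g zero λ ())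
    (∑-agree-off (f ∘ suc) (g ∘ suc) p λ i i≢p → f≗g (suc i) λ { refl → i≢p refl }) ⟩
  g zero + (∑ (g ∘ suc) + f (suc p))  ≡⟨ +-assoc (g zero) _ _ ⟨
  g zero + ∑ (g ∘ suc) + f (suc p)    ∎
  where open ≡-Reasoning

∑-agree-off₂-< : ∀ {n} (f g : Fin n → ℕ) {p q} → p ≢ q →
  (∀ i → i ≢ p → i ≢ q → f i ≡ g i) → f p + f q < g p + g q → ∑ f < ∑ g
∑-agree-off₂-< f g {p} {q} p≢q f≗g lt = +-cancelʳ-< (g p + g q) _ _ (begin-strict
  ∑ f + (g p + g q)  ≡⟨ +-assoc (∑ f) _ _ ⟨
  ∑ f + g p + g q    ≡⟨ cong (_+ g q) f→h ⟩
  ∑ h + f p + g q    ≡⟨ +-comm-last (∑ h) (f p) (g q) ⟩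
  ∑ h + g q + f p    ≡⟨ cong (_+ f p) h→g ⟩
  ∑ g + f q + f p    ≡⟨ +-comm-last (∑ g) (f q) (f p) ⟩
  ∑ g + f p + f q    ≡⟨ +-assoc (∑ g) _ _ ⟩
  ∑ g + (f p + f q)  <⟨ +-monoʳ-< (∑ g) lt ⟩
  ∑ g + (g p + g q)  ∎)
  where
  open ≤-Reasoning
  -- An intermediate function: it differs from `f` only at `p` and from `g` only at `q`.
  h = updateAt f p (λ _ → g p)
  h≡f : ∀ i → i ≢ p → h i ≡ f i
  h≡f i i≢p = updateAt-minimal i p f i≢p
  hp≡gp : h p ≡ g p
  hp≡gp = updateAt-updates p f
  +-comm-last : ∀ a b c → a + b + c ≡ a + c + b
  +-comm-last = solve-∀
  f→h : ∑ f + g p ≡ ∑ h + f p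
  f→h = trans (cong (∑ f +_) (sym hp≡gp)) (∑-agree-off f h p λ i i≢p → sym (h≡f i i≢p))
  h≗g : ∀ i → i ≢ q → h i ≡ g i
  h≗g i i≢q with i ≟ᶠ p
  ... | yes refl = hp≡gp
  ... | no i≢p = trans (h≡f i i≢p) (f≗g i i≢p i≢q)
  h→g : ∑ h + g q ≡ ∑ g + f q
  h→g = trans (∑-agree-off h g q h≗g) (cong (∑ g +_) (h≡f q (p≢q ∘ sym)))

rearrangement : ∀ {a b c d} → a < b → c < d → a * d + b * c < a * c + b * d
rearrangement {a} {b} {c} {d} a<b c<d =
  -- With `b` written as `a + e`, the two sides differ only in `e * c` against `e * d`.
  subst (λ x → a * d + x * c < a * c + x * d) (m+[n∸m]≡n (<⇒≤ a<b)) (begin-strict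
    a * d + (a + e) * c      ≡⟨ expandˡ a c d e ⟩
    a * c + a * d + e * c    <⟨ +-monoʳ-< (a * c + a * d) (*-monoʳ-< e c<d) ⟩
    a * c + a * d + e * d    ≡⟨ expandʳ a c d e ⟩
    a * c + (a + e) * d      ∎)
  where
  open ≤-Reasoning
  e = b ∸ a
  instance _ = >-nonZero (m<n⇒0<n∸m a<b)
  expandˡ : ∀ a c d e → a * d + (a + e) * c ≡ a * c + a * d + e * c
  expandˡ = solve-∀
  expandʳ : ∀ a c d e → a * c + a * d + e * d ≡ a * c + (a + e) * d
  expandʳ = solve-∀

-- Exchanging two entries of a permutation.

⟨$⟩ʳ-injective : ∀ {n} (π : Permutation′ n) → Injective _≡_ _≡_ (π ⟨$⟩ʳ_)
⟨$⟩ʳ-injective π = Injection.injective (↔⇒↣ π)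

val-injective : ∀ {n} (π : Permutation′ n) → Injective _≡_ _≡_ (val π)
val-injective π = ⟨$⟩ʳ-injective π ∘ toℕ-injective

-- `_∘ₚ_` applies its left argument first, so the transposition acts on positions.
swap : ∀ {n} → Fin n → Fin n → Permutation′ n → Permutation′ n
swap p q π = transpose p q ∘ₚ π

module _ {n} (p q : Fin n) (π : Permutation′ n) where

  swap-left : swap p q π ⟨$⟩ʳ p ≡ π ⟨$⟩ʳ q
  swap-left rewrite dec-true (p ≟ᶠ p) refl = refl

  swap-right : swap p q π ⟨$⟩ʳ q ≡ π ⟨$⟩ʳ p
  swap-right with q ≟ᶠ p
  ... | yes refl = refl
  ... | no _ rewrite dec-true (q ≟ᶠ q) refl = refl

  swap-other : ∀ i → i ≢ p → i ≢ q → swap p q π ⟨$⟩ʳ i ≡ π ⟨$⟩ʳ i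
  swap-other i i≢p i≢q rewrite dec-false (i ≟ᶠ p) i≢p | dec-false (i ≟ᶠ q) i≢q = refl

module _ {n} (w : Fin n → ℕ) where

  energy : Permutation′ n → ℕ
  energy π = ∑ λ i → w i * val π i

  energy-bounded : ∀ π → energy π ≤ ∑ λ i → w i * n
  energy-bounded π = ∑-mono λ i → *-monoʳ-≤ (w i) (<⇒≤ (toℕ<n (π ⟨$⟩ʳ i)))

  energy-swap : ∀ π {p q} → w p < w q → val π q < val π p → energy π < energy (swap p q π)
  energy-swap π {p} {q} wp<wq πq<πp = ∑-agree-off₂-< _ _
    (λ { refl → <-irrefl refl wp<wq })
    (λ i i≢p i≢q → cong (λ x → w i * toℕ x) (sym (swap-other p q π i i≢p i≢q)))
    (subst₂ (λ x y → w p * val π p + w q * val π q < w p * toℕ x + w q * toℕ y)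
      (sym (swap-left p q π)) (sym (swap-right p q π)) (rearrangement wp<wq πq<πp))

-- Chains below a cell, big entries, and refilling the big positions.

-- An increasing subsequence of length `j`, listed from its top, strictly left of and below the cell
-- `(p, v)`. The cell need not be an entry of `π`, so one can ask whether a value would fit at a
-- position.
Chain : ∀ {n} → Permutation′ n → ℕ → ℕ → ℕ → Set
Chain π zero p v = ⊤
Chain π (suc j) p v = ∃[ q ] (toℕ q < p × val π q < v × Chain π j (toℕ q) (val π q))

chain? : ∀ {n} (π : Permutation′ n) j p v → Dec (Chain π j p v)
chain? π zero p v = yes tt
chain? π (suc j) p v = any? λ q →
  (toℕ q <? p) ×-dec (val π q <? v) ×-dec chain? π j (toℕ q) (val π q)

chain-mono : ∀ {n} (π : Permutation′ n) j {p p′ v v′} →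
  p ≤ p′ → v ≤ v′ → Chain π j p v → Chain π j p′ v′
chain-mono π zero p≤ v≤ c = tt
chain-mono π (suc j) p≤ v≤ (q , q<p , πq<v , c) = q , <-≤-trans q<p p≤ , <-≤-trans πq<v v≤ , c

module _ (m : ℕ) {n : ℕ} where

  Big : Permutation′ n → Fin n → Set
  Big π p = Chain π m (toℕ p) (val π p)

  big? : ∀ π p → Dec (Big π p)
  big? π p = chain? π m (toℕ p) (val π p)

  infix 4 _~_
  record _~_ (π σ : Permutation′ n) : Set where
    field
      cells  : ∀ p v → Chain π m p v ⇔ Chain σ m p v
      bigs   : ∀ p → Big π p ⇔ Big σ p
      smalls : ∀ p → ¬ Big π p → π ⟨$⟩ʳ p ≡ σ ⟨$⟩ʳ p

  open _~_

  ~-sym : ∀ {π σ} → π ~ σ → σ ~ π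
  ~-sym e = record
    { cells = λ p v → ⇔-sym (cells e p v)
    ; bigs = λ p → ⇔-sym (bigs e p)
    ; smalls = λ p small → sym (smalls e p (small ∘ to (bigs e p)))
    }

  ~-trans : ∀ {π σ ρ} → π ~ σ → σ ~ ρ → π ~ ρ
  ~-trans e e′ = record
    { cells = λ p v → cells e′ p v ⇔-∘ cells e p v
    ; bigs = λ p → bigs e′ p ⇔-∘ bigs e p
    ; smalls = λ p small → trans (smalls e p small) (smalls e′ p (small ∘ from (bigs e p)))
    }

  module _ {π σ : Permutation′ n}
    (agree : ∀ p → ¬ Big π p → π ⟨$⟩ʳ p ≡ σ ⟨$⟩ʳ p)
    (fits : ∀ p → Big π p → Chain π m (toℕ p) (val σ p)) where

    private
      chain-or-big : ∀ j {p v} → Chain π j p v →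
        Chain σ j p v ⊎ ∃[ q ] (toℕ q < p × val π q < v × Big π q)
      chain-or-big zero c = inj₁ tt
      chain-or-big (suc j) (q , q<p , πq<v , c) with big? π q | chain-or-big j c
      ... | yes big | _ = inj₂ (q , q<p , πq<v , big)
      ... | no _ | inj₂ (r , r<q , πr<πq , big) =
        inj₂ (r , <-trans r<q q<p , <-trans πr<πq πq<v , big)
      ... | no small | inj₁ c′ rewrite agree q small = inj₁ (q , q<p , πq<v , c′)

      -- A chain of small entries is shared by `σ`. Otherwise it contains a big entry, which has a
      -- chain of length `m` of its own further left; the induction is on position.
      chain-to : ∀ p v → Acc _<_ p → Chain π m p v → Chain σ m p v
      chain-to p v (acc rec) c with chain-or-big m c
      ... | inj₁ c′ = c′
      ... | inj₂ (q , q<p , πq<v , big) =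
        chain-mono σ m (<⇒≤ q<p) (<⇒≤ πq<v) (chain-to _ _ (rec q<p) big)

      -- As soon as the chain meets a big position, `fits` supplies a full chain of length `m` in
      -- `π`. At `j = m` the two alternatives coincide.
      chain-from : ∀ j {p v} → Chain σ j p v → Chain π j p v ⊎ Chain π m p v
      chain-from zero c = inj₁ tt
      chain-from (suc j) (q , q<p , σq<v , c) with big? π q | chain-from j c
      ... | yes big | _ = inj₂ (chain-mono π m (<⇒≤ q<p) (<⇒≤ σq<v) (fits q big))
      ... | no _ | inj₂ c′ = inj₂ (chain-mono π m (<⇒≤ q<p) (<⇒≤ σq<v) c′)
      ... | no small | inj₁ c′ rewrite sym (agree q small) = inj₁ (q , q<p , σq<v , c′)

      same-cells : ∀ p v → Chain π m p v ⇔ Chain σ m p v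
      same-cells p v = mk⇔ (chain-to p v (<-wellFounded p)) λ c → reduce (chain-from m c)

      big-from : ∀ p → Big σ p → Big π p
      big-from p bigσ with big? π p
      ... | yes big = big
      ... | no small rewrite agree p small = from (same-cells _ _) bigσ

    refill : π ~ σ
    refill = record
      { cells = same-cells
      ; bigs = λ p → mk⇔ (to (same-cells _ _) ∘ fits p) (big-from p)
      ; smalls = agree
      }

  ≈⇒~ : ∀ {π σ} → π ≈ₚ σ → π ~ σ
  ≈⇒~ {π} π≈σ = refill (λ p _ → π≈σ p) (λ p → subst (Chain π m (toℕ p) ∘ toℕ) (π≈σ p))

  -- Existence and uniqueness of sorted fillings.

  Sorted : (Fin n → ℕ) → Permutation′ n → Set
  Sorted w π = ∀ p q → Big π q → w p < w q → val π q < val π p →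
    ¬ Chain π m (toℕ p) (val π q)

  -- The chain at `(p, π q)` also makes `p` big, and the larger value `π p` fits at `q` because `q`
  -- is big; so the exchange is a refilling.
  swap-~ : ∀ π {p q} → Big π q → val π q < val π p → Chain π m (toℕ p) (val π q) →
    π ~ swap p q π
  swap-~ π {p} {q} bigq πq<πp c = refill agree fits
    where
    bigp : Big π p
    bigp = chain-mono π m ≤-refl (<⇒≤ πq<πp) c
    agree : ∀ i → ¬ Big π i → π ⟨$⟩ʳ i ≡ swap p q π ⟨$⟩ʳ i
    agree i small = sym (swap-other p q π i (λ { refl → small bigp }) (λ { refl → small bigq }))
    fits : ∀ i → Big π i → Chain π m (toℕ i) (val (swap p q π) i)
    fits i big with i ≟ᶠ p
    ... | yes refl = c
    ... | no i≢p with i ≟ᶠ q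
    ...   | yes refl = chain-mono π m ≤-refl (<⇒≤ πq<πp) bigq
    ...   | no i≢q = big

  sort : ∀ w π → ∃[ σ ] (π ~ σ × Sorted w σ)
  sort w π = go π (<-wellFounded _)
    where
    bound = ∑ λ i → w i * n
    go : ∀ π → Acc _<_ (bound ∸ energy w π) → ∃[ σ ] (π ~ σ × Sorted w σ)
    go π (acc rec) with any? (λ p → any? λ q → big? π q ×-dec (w p <? w q)
      ×-dec (val π q <? val π p) ×-dec chain? π m (toℕ p) (val π q))
    ... | no sorted = π , ≈⇒~ (λ _ → refl) ,
      λ p q big w< π> c → sorted (p , q , big , w< , π> , c)
    ... | yes (p , q , big , w< , π> , c)
      with σ , e , s ← go (swap p q π)
        (rec (∸-monoʳ-< (energy-swap w π w< π>) (energy-bounded w (swap p q π))))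
      = σ , ~-trans (swap-~ π big π> c) e , s

  -- Take the position `p` of least weight where the two differ, say with `π p < σ p`. The value
  -- `π p` sits in `σ` at a big position of larger weight, and it fits at `p`, so `σ` admits an
  -- exchange.
  sorted-unique : ∀ w → Injective _≡_ _≡_ w → ∀ {π σ} → π ~ σ →
    Sorted w π → Sorted w σ → π ≈ₚ σ
  sorted-unique w w-inj {π} {σ} π~σ sπ sσ p = go p (<-wellFounded (w p))
    where
    ¬smaller : ∀ {π σ p} → π ~ σ → Sorted w σ → Big π p →
      (∀ q → w q < w p → π ⟨$⟩ʳ q ≡ σ ⟨$⟩ʳ q) → ¬ val π p < val σ p
    ¬smaller {π} {σ} {p} π~σ sσ bigp before πp<σp = absurd (<-cmp (w p) (w q))
      where
      q = σ ⟨$⟩ˡ (π ⟨$⟩ʳ p)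
      σq≡πp : σ ⟨$⟩ʳ q ≡ π ⟨$⟩ʳ p
      σq≡πp = inverseʳ σ
      q≢p : q ≢ p
      q≢p q≡p = <-irrefl (cong toℕ (trans (sym σq≡πp) (cong (σ ⟨$⟩ʳ_) q≡p))) πp<σp
      moved : π ⟨$⟩ʳ q ≢ σ ⟨$⟩ʳ q
      moved πq≡σq = q≢p (⟨$⟩ʳ-injective π (trans πq≡σq σq≡πp))
      bigq : Big σ q
      bigq with big? π q
      ... | yes big = to (bigs π~σ q) big
      ... | no small = contradiction (smalls π~σ q small) moved
      absurd : _ → ⊥
      absurd (tri< wp<wq _ _) = sσ p q bigq wp<wq
        (subst (λ v → toℕ v < val σ p) (sym σq≡πp) πp<σp)
        (subst (Chain σ m (toℕ p) ∘ toℕ) (sym σq≡πp) (to (cells π~σ _ _) bigp))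
      absurd (tri≈ _ wp≡wq _) = q≢p (w-inj (sym wp≡wq))
      absurd (tri> _ _ wq<wp) = moved (before q wq<wp)

    go : ∀ p → Acc _<_ (w p) → π ⟨$⟩ʳ p ≡ σ ⟨$⟩ʳ p
    go p (acc rec) with big? π p
    ... | no small = smalls π~σ p small
    ... | yes big with <-cmp (val π p) (val σ p)
    ...   | tri≈ _ eq _ = toℕ-injective eq
    ...   | tri< lt _ _ = contradiction lt
      (¬smaller π~σ sσ big λ q lt → go q (rec lt))
    ...   | tri> _ _ gt = contradiction gt
      (¬smaller (~-sym π~σ) sπ (to (bigs π~σ p) big) λ q lt → sym (go q (rec lt)))

-- Translation between chains and pattern occurrences.

Increasing : ℕ → (ℕ → ℕ) → Set
Increasing k g = ∀ i j → i < j → j < k → g i < g j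

Below : ℕ → (ℕ → ℕ) → ℕ → Set
Below k g u = ∀ i → i < k → g i < u

-- A sequence of length `k` is a total function read only below `k`, so appending means overwriting
-- the term at `k`.
snoc : ∀ {A : Set} → (ℕ → A) → ℕ → A → ℕ → A
snoc e k x i with i ≟ k
... | yes _ = x
... | no _ = e i

module _ {A : Set} (e : ℕ → A) (k : ℕ) (x : A) where

  snoc-last : snoc e k x k ≡ x
  snoc-last with k ≟ k
  ... | yes _ = refl
  ... | no k≢k = contradiction refl k≢k

  snoc-init : ∀ {i} → i < k → snoc e k x i ≡ e i
  snoc-init {i} i<k with i ≟ k
  ... | yes refl = contradiction i<k (<-irrefl refl)
  ... | no _ = refl

  module _ (h : A → ℕ) where

    snoc-below : ∀ {u} → Below k (h ∘ e) u → h x < u → Below (suc k) (h ∘ snoc e k x) u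
    snoc-below below hx<u i i<1+k with i ≟ k
    ... | yes _ = hx<u
    ... | no i≢k = below i (≤∧≢⇒< (s≤s⁻¹ i<1+k) i≢k)

    snoc-increasing : Increasing k (h ∘ e) → Below k (h ∘ e) (h x) →
      Increasing (suc k) (h ∘ snoc e k x)
    snoc-increasing incr below i j i<j j<1+k with j ≟ k
    ... | yes refl rewrite snoc-init i<j = below i i<j
    ... | no j≢k = subst (λ y → h y < h (e j)) (sym (snoc-init (<-trans i<j j<k)))
      (incr i j i<j j<k)
      where j<k = ≤∧≢⇒< (s≤s⁻¹ j<1+k) j≢k

chain⇒sequence : ∀ {n} (π : Permutation′ n) → Fin n → ∀ j {p v} → Chain π j p v →
  ∃[ e ] (Increasing j (toℕ ∘ e) × Below j (toℕ ∘ e) p ×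
          Increasing j (val π ∘ e) × Below j (val π ∘ e) v)
-- `d` is a default for terms beyond the length.
chain⇒sequence π d zero c = (λ _ → d) , (λ _ _ _ ()) , (λ _ ()) , (λ _ _ _ ()) , (λ _ ())
chain⇒sequence π d (suc j) (q , q<p , πq<v , c)
  with e , incr , below , incr′ , below′ ← chain⇒sequence π d j c =
  snoc e j q ,
  snoc-increasing e j q toℕ incr below ,
  snoc-below e j q toℕ (λ i i<j → <-trans (below i i<j) q<p) q<p ,
  snoc-increasing e j q (val π) incr′ below′ ,
  snoc-below e j q (val π) (λ i i<j → <-trans (below′ i i<j) πq<v) πq<v

occurrence⇒chain : ∀ {k n} (π : Permutation′ n) (ι : Fin k → Fin n) j {p v} → j ≤ k →
  StrictlyIncreasing ι →
  (∀ a b → toℕ a < toℕ b → toℕ b < j → val π (ι a) < val π (ι b)) →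
  (∀ a → toℕ a < j → toℕ (ι a) < p × val π (ι a) < v) → Chain π j p v
occurrence⇒chain π ι zero j≤k incr incr′ below = tt
occurrence⇒chain π ι (suc j) j<k incr incr′ below =
  ι a , proj₁ (below a a<1+j) , proj₂ (below a a<1+j) ,
  occurrence⇒chain π ι j (<⇒≤ j<k) incr
    (λ b c b<c c<j → incr′ b c b<c (m<n⇒m<1+n c<j))
    (λ b b<j → let b<a = subst (toℕ b <_) (sym a≡j) b<j in incr b a b<a , incr′ b a b<a a<1+j)
  where
  a = fromℕ< j<k
  a≡j : toℕ a ≡ j
  a≡j = toℕ-fromℕ< j<k
  a<1+j : toℕ a < suc j
  a<1+j = subst (_< suc j) (sym a≡j) ≤-refl

-- `g` lists the values of the occurrence in increasing order and `τ` gives their ranks, so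
-- monotonicity of `g` settles every comparison.
orderIso : ∀ {k n} (π : Permutation′ n) (ι : Fin k → Fin n) (τ : Fin k → ℕ) (g : ℕ → ℕ) →
  Increasing k g → (∀ a → τ a < k) → (∀ a → val π (ι a) ≡ g (τ a)) → OrderIso π ι τ
orderIso π ι τ g incr τ<k val≡ a b = mk⇔
  (λ τa<τb → subst₂ _<_ (sym (val≡ a)) (sym (val≡ b)) (incr _ _ τa<τb (τ<k b)))
  (λ lt → reflect (subst₂ _<_ (val≡ a) (val≡ b) lt))
  where
  reflect : g (τ a) < g (τ b) → τ a < τ b
  reflect lt with <-cmp (τ a) (τ b)
  ... | tri< τa<τb _ _ = τa<τb
  ... | tri≈ _ eq _ = contradiction lt (<-irrefl (cong g eq))
  ... | tri> _ _ τb<τa = contradiction lt (<-asym (incr _ _ τb<τa (τ<k a)))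

module _ (m : ℕ) where

  penultimateIndex lastIndex : Fin (2 + m)
  penultimateIndex = fromℕ< (m<n⇒m<1+n ≤-refl)
  lastIndex = fromℕ< ≤-refl

  toℕ-penultimateIndex : toℕ penultimateIndex ≡ m
  toℕ-penultimateIndex = toℕ-fromℕ< (m<n⇒m<1+n ≤-refl)

  toℕ-lastIndex : toℕ lastIndex ≡ suc m
  toℕ-lastIndex = toℕ-fromℕ< ≤-refl

  data View (a : Fin (2 + m)) : Set where
    init        : toℕ a < m → View a
    penultimate : toℕ a ≡ m → View a
    last        : toℕ a ≡ suc m → View a

  view : ∀ a → View a
  view a with <-cmp (toℕ a) m
  ... | tri< a<m _ _ = init a<m
  ... | tri≈ _ a≡m _ = penultimate a≡m
  ... | tri> _ _ m<a = last (≤-antisym (s≤s⁻¹ (toℕ<n a)) m<a)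

  G-init : ∀ a → toℕ a < m → G (2 + m) a ≡ toℕ a
  G-init a a<m with toℕ a ≟ m
  ... | yes a≡m = contradiction a<m (<-irrefl a≡m)
  ... | no _ with toℕ a ≟ suc m
  ...   | yes a≡1+m = contradiction (m<n⇒m<1+n a<m) (<-irrefl a≡1+m)
  ...   | no _ = refl

  G-penultimate : ∀ a → toℕ a ≡ m → G (2 + m) a ≡ suc m
  G-penultimate a a≡m with toℕ a ≟ m
  ... | yes _ = refl
  ... | no a≢m = contradiction a≡m a≢m

  G-last : ∀ a → toℕ a ≡ suc m → G (2 + m) a ≡ m
  G-last a a≡1+m with toℕ a ≟ m
  ... | yes a≡m = contradiction (trans (sym a≡m) a≡1+m) (<⇒≢ ≤-refl)
  ... | no _ with toℕ a ≟ suc m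
  ...   | yes _ = refl
  ...   | no a≢1+m = contradiction a≡1+m a≢1+m

  G< : ∀ a → G (2 + m) a < 2 + m
  G< a with view a
  ... | init a<m rewrite G-init a a<m = m<n⇒m<1+n (m<n⇒m<1+n a<m)
  ... | penultimate a≡m rewrite G-penultimate a a≡m = ≤-refl
  ... | last a≡1+m rewrite G-last a a≡1+m = m<n⇒m<1+n ≤-refl

  endsWith : ∀ {n} → (Fin (2 + m) → Fin n) → Fin n → Fin n → Set
  endsWith ι p q = (∀ a → toℕ a ≡ m → ι a ≡ p) × (∀ a → toℕ a ≡ suc m → ι a ≡ q)

  module _ {n} (π : Permutation′ n) where

    chain⇒J : ∀ {p q} → toℕ p < toℕ q → val π p < val π q → Chain π m (toℕ p) (val π p) →
      ∃[ ι ] (Occurrence π (J (2 + m)) ι × endsWith ι p q)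
    chain⇒J {p} {q} p<q πp<πq c
      with e , incr , below , incr′ , below′ ← chain⇒sequence π p m c =
      (λ a → s (toℕ a)) ,
      ((λ a b a<b → s-increasing toℕ p<q incr below (toℕ a) (toℕ b) a<b (toℕ<n b)) ,
       orderIso π _ toℕ (val π ∘ s) (s-increasing (val π) πp<πq incr′ below′) toℕ<n (λ _ → refl)) ,
      (λ a a≡m → trans (cong s a≡m)
        (trans (snoc-init (snoc e m p) (suc m) q ≤-refl) (snoc-last e m p))) ,
      (λ a a≡1+m → trans (cong s a≡1+m) (snoc-last _ (suc m) q))
      where
      s = snoc (snoc e m p) (suc m) q
      s-increasing : ∀ h → h p < h q → Increasing m (h ∘ e) → Below m (h ∘ e) (h p) →
        Increasing (2 + m) (h ∘ s)
      s-increasing h hp<hq incr below = snoc-increasing _ _ q h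
        (snoc-increasing e m p h incr below)
        (snoc-below e m p h (λ i i<m → <-trans (below i i<m) hp<hq) hp<hq)

    chain⇒G : ∀ {p q} → toℕ p < toℕ q → val π q < val π p → Chain π m (toℕ p) (val π q) →
      ∃[ ι ] (Occurrence π (G (2 + m)) ι × endsWith ι p q)
    chain⇒G {p} {q} p<q πq<πp c
      with e , incr , below , incr′ , below′ ← chain⇒sequence π p m c =
      (λ a → s p q (toℕ a)) ,
      ((λ a b a<b → s-increasing toℕ p<q incr below (toℕ a) (toℕ b) a<b (toℕ<n b)) ,
       -- Positions increase with `p` before `q`, values with `q` before `p`; `G` is the
       -- transposition relating the two lists.
       orderIso π _ (G (2 + m)) (val π ∘ s q p) (s-increasing (val π) πq<πp incr′ below′)
         G< (λ a → cong (val π) (sorted a))) ,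
      (λ a a≡m → trans (cong (s p q) a≡m) (s-penultimate p q)) ,
      (λ a a≡1+m → trans (cong (s p q) a≡1+m) (s-last p q))
      where
      s : Fin n → Fin n → ℕ → Fin n
      s x y = snoc (snoc e m x) (suc m) y
      s-init : ∀ x y {i} → i < m → s x y i ≡ e i
      s-init x y i<m = trans (snoc-init _ _ y (m<n⇒m<1+n i<m)) (snoc-init e m x i<m)
      s-penultimate : ∀ x y → s x y m ≡ x
      s-penultimate x y = trans (snoc-init (snoc e m x) (suc m) y ≤-refl) (snoc-last e m x)
      s-last : ∀ x y → s x y (suc m) ≡ y
      s-last x y = snoc-last _ (suc m) y
      s-increasing : ∀ h {x y} → h x < h y → Increasing m (h ∘ e) → Below m (h ∘ e) (h x) →
        Increasing (2 + m) (h ∘ s x y)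
      s-increasing h {x} {y} hx<hy incr below = snoc-increasing _ _ y h
        (snoc-increasing e m x h incr below)
        (snoc-below e m x h (λ i i<m → <-trans (below i i<m) hx<hy) hx<hy)
      sorted : ∀ a → s p q (toℕ a) ≡ s q p (G (2 + m) a)
      sorted a with view a
      ... | init a<m rewrite G-init a a<m = trans (s-init p q a<m) (sym (s-init q p a<m))
      ... | penultimate a≡m rewrite G-penultimate a a≡m | a≡m =
        trans (s-penultimate p q) (sym (s-last q p))
      ... | last a≡1+m rewrite G-last a a≡1+m | a≡1+m =
        trans (s-last p q) (sym (s-penultimate q p))

    -- Common to `J` and `G`: the first `m` entries lie left of `ι a` and below both final values,
    -- hence below their minimum.
    occurrence-end : ∀ {ι τ} → Occurrence π τ ι → (∀ a → toℕ a < m → τ a ≡ toℕ a) →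
      ∀ a b → toℕ a ≡ m → m ≤ τ a → m ≤ τ b → Chain π m (toℕ (ι a)) (val π (ι a) ⊓ val π (ι b))
    occurrence-end {ι} {τ} (incr , iso) τ-init a b a≡m m≤τa m≤τb =
      occurrence⇒chain π ι m (m≤n+m m 2) incr
        (λ c d c<d d<m → to (iso c d)
          (subst₂ _<_ (sym (τ-init c (<-trans c<d d<m))) (sym (τ-init d d<m)) c<d))
        (λ c c<m → incr c a (subst (toℕ c <_) (sym a≡m) c<m) ,
          ⊓-glb (to (iso c a) (τ< c c<m m≤τa)) (to (iso c b) (τ< c c<m m≤τb)))
      where
      τ< : ∀ c {d} → toℕ c < m → m ≤ τ d → τ c < τ d
      τ< c c<m m≤τd = subst (_< τ _) (sym (τ-init c c<m)) (<-≤-trans c<m m≤τd)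

    J⇒chain : ∀ {ι} → Occurrence π (J (2 + m)) ι → ∀ a b → toℕ a ≡ m → toℕ b ≡ suc m →
      toℕ (ι a) < toℕ (ι b) × val π (ι a) < val π (ι b) × Chain π m (toℕ (ι a)) (val π (ι a))
    J⇒chain occ@(incr , iso) a b a≡m b≡1+m =
      incr a b a<b , to (iso a b) a<b ,
      chain-mono π m ≤-refl (m⊓n≤m _ _)
        (occurrence-end occ (λ _ _ → refl) a b a≡m
          (≤-reflexive (sym a≡m)) (≤-trans (n≤1+n m) (≤-reflexive (sym b≡1+m))))
      where
      a<b : toℕ a < toℕ b
      a<b = subst₂ _<_ (sym a≡m) (sym b≡1+m) ≤-refl

    G⇒chain : ∀ {ι} → Occurrence π (G (2 + m)) ι → ∀ a b → toℕ a ≡ m → toℕ b ≡ suc m →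
      toℕ (ι a) < toℕ (ι b) × val π (ι b) < val π (ι a) × Chain π m (toℕ (ι a)) (val π (ι b))
    G⇒chain occ@(incr , iso) a b a≡m b≡1+m =
      incr a b (subst₂ _<_ (sym a≡m) (sym b≡1+m) ≤-refl) ,
      to (iso b a) (subst₂ _<_ (sym Gb) (sym Ga) ≤-refl) ,
      chain-mono π m ≤-refl (m⊓n≤n (val π _) _)
        (occurrence-end occ G-init a b a≡m
          (≤-trans (n≤1+n m) (≤-reflexive (sym Ga))) (≤-reflexive (sym Gb)))
      where
      Ga = G-penultimate a a≡m
      Gb = G-last b b≡1+m

-- Adjacent positions and runs of big entries.

climb : ∀ {n} (P : Fin n → Set) {p} → P p →
  (∀ r s → toℕ p ≤ toℕ r → toℕ s ≡ suc (toℕ r) → P r → P s) → ∀ s → toℕ p ≤ toℕ s → P s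
climb P {p} base step s = go (toℕ s) s refl
  where
  go : ∀ i s → toℕ s ≡ i → toℕ p ≤ i → P s
  go i s s≡i p≤i with m≤n⇒m<n∨m≡n p≤i
  ... | inj₂ p≡i = subst P (toℕ-injective (trans p≡i (sym s≡i))) base
  go (suc i) s s≡i p≤i | inj₁ (s≤s p≤i′) =
    step r s (subst (toℕ p ≤_) (sym r≡i) p≤i′) (trans s≡i (cong suc (sym r≡i))) (go i r r≡i p≤i′)
    where
    i<n = <-trans (subst (i <_) (sym s≡i) ≤-refl) (toℕ<n s)
    r = fromℕ< i<n
    r≡i : toℕ r ≡ i
    r≡i = toℕ-fromℕ< i<n

-- The top of the chain has value below `v`, hence is not the entry at `p`, so it lies left of `p`.
chain-pred : ∀ {n} (π : Permutation′ n) j {p q : Fin n} {v} → toℕ q ≡ suc (toℕ p) → v ≤ val π p →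
  Chain π j (toℕ q) v → Chain π j (toℕ p) v
chain-pred π zero q≡1+p v≤πp c = tt
chain-pred π (suc j) {p} {q} q≡1+p v≤πp (r , r<q , πr<v , c) =
  r , ≤∧≢⇒< (s≤s⁻¹ (subst (toℕ r <_) q≡1+p r<q)) r≢p , πr<v , c
  where
  r≢p : toℕ r ≢ toℕ p
  r≢p eq = <-irrefl (cong (val π) (toℕ-injective eq)) (<-≤-trans πr<v v≤πp)

nondescent⇒rise : ∀ {n} (π : Permutation′ n) {p q : Fin n} → toℕ q ≡ suc (toℕ p) →
  ¬ val π q < val π p → val π p < val π q
nondescent⇒rise π q≡1+p ¬descent = ≤∧≢⇒< (≮⇒≥ ¬descent)
  λ eq → <-irrefl (cong toℕ (val-injective π eq)) (≤-reflexive (sym q≡1+p))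

module _ (m : ℕ) {n : ℕ} where

  RunsRise : Permutation′ n → Set
  RunsRise π = ∀ p q → toℕ q ≡ suc (toℕ p) → Big m π p → Big m π q → val π p < val π q

  module _ (π : Permutation′ n) where

    runsRise-≤ : RunsRise π → ∀ {p q} → toℕ p < toℕ q → Big m π p →
      (∀ r → toℕ p < toℕ r → toℕ r ≤ toℕ q → Big m π r) → val π p ≤ val π q
    runsRise-≤ rise {p} {q} p<q bigp big =
      climb (λ s → toℕ s ≤ toℕ q → Big m π s × val π p ≤ val π s)
        (λ _ → bigp , ≤-refl) step q (<⇒≤ p<q) ≤-refl .proj₂
      where
      step : ∀ r s → toℕ p ≤ toℕ r → toℕ s ≡ suc (toℕ r) →
        (toℕ r ≤ toℕ q → Big m π r × val π p ≤ val π r) →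
        toℕ s ≤ toℕ q → Big m π s × val π p ≤ val π s
      step r s p≤r s≡1+r ih s≤q
        with r<s ← ≤-reflexive (sym s≡1+r)
        with bigr , πp≤πr ← ih (≤-trans (<⇒≤ r<s) s≤q)
        with bigs ← big s (≤-<-trans p≤r r<s) s≤q =
        bigs , ≤-trans πp≤πr (<⇒≤ (rise r s s≡1+r bigr bigs))

    -- Otherwise the chain under `q` lies left of `p` and below it, making `p` big.
    small⇒big-rises : ∀ {p q} → toℕ q ≡ suc (toℕ p) → ¬ Big m π p → Big m π q → val π p < val π q
    small⇒big-rises q≡1+p small bigq = ≰⇒> λ πq≤πp →
      small (chain-mono π m ≤-refl πq≤πp (chain-pred π m q≡1+p πq≤πp bigq))

    big⇒small-descends : ∀ {p q} → toℕ q ≡ suc (toℕ p) → Big m π p → ¬ Big m π q → val π q < val π p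
    big⇒small-descends q≡1+p bigp small = ≰⇒> λ πp≤πq →
      small (chain-mono π m (≤-trans (n≤1+n _) (≤-reflexive (sym q≡1+p))) πp≤πq bigp)

  -- On big entries such a weight orders the runs of consecutive big positions from right to left,
  -- and each run from left to right.
  record RunWeight (π : Permutation′ n) (w : Fin n → ℕ) : Set where
    field
      within : ∀ p q → toℕ p < toℕ q →
        (∀ r → toℕ p < toℕ r → toℕ r ≤ toℕ q → Big m π r) → w p < w q
      across : ∀ p q s → toℕ p < toℕ s → toℕ s < toℕ q → ¬ Big m π s → w q < w p

  open RunWeight

  runWeight-resp : ∀ {π σ : Permutation′ n} {w} → _~_ m π σ → RunWeight π w → RunWeight σ w
  runWeight-resp e rw = record
    { within = λ p q p<q big → within rw p q p<q λ r p<r r≤q → from (bigs r) (big r p<r r≤q)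
    ; across = λ p q s p<s s<q small → across rw p q s p<s s<q (small ∘ to (bigs s))
    }
    where open _~_ e

  -- Avoidance as sortedness.

  -- A descent between adjacent big entries ends an occurrence of Q_k whose ascending stretch is the
  -- single entry `p`.
  avoidsQ⇒runsRise : ∀ {π : Permutation′ n} → ¬ ContainsQ (2 + m) π → RunsRise π
  avoidsQ⇒runsRise {π} avoidsQ p q q≡1+p bigp bigq = nondescent⇒rise π q≡1+p descent-impossible
    where
    descent-impossible : ¬ val π q < val π p
    descent-impossible πq<πp
      with ι , occ , ι-p , ι-q ← chain⇒G m π (≤-reflexive (sym q≡1+p)) πq<πp
        (chain-pred π m q≡1+p (<⇒≤ πq<πp) bigq) =
      avoidsQ (ι , occ , _ , _ , toℕ-penultimateIndex m , toℕ-lastIndex m , ascending , top)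
      where
      ascending : ∀ r s → toℕ (ι (penultimateIndex m)) ≤ toℕ r → toℕ s ≡ suc (toℕ r) →
        toℕ s < toℕ (ι (lastIndex m)) → val π r < val π s
      ascending r s p≤r s≡1+r s<q
          rewrite ι-p _ (toℕ-penultimateIndex m) | ι-q _ (toℕ-lastIndex m) | q≡1+p | s≡1+r =
        -- No consecutive pair fits strictly before `q` when starting at `p`, so the condition is
        -- vacuous.
        contradiction p≤r (<⇒≱ (s≤s⁻¹ s<q))
      top : ∀ r → toℕ (ι (lastIndex m)) ≡ suc (toℕ r) → val π (ι (lastIndex m)) < val π r
      top r ιb≡1+r rewrite ι-q _ (toℕ-lastIndex m) =
        subst (λ x → val π q < val π x)
          (toℕ-injective (suc-injective (trans (sym q≡1+p) ιb≡1+r))) πq<πp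

  module _ {π : Permutation′ n} {w : Fin n → ℕ} where

    -- By `chain-pred` the smaller value of an adjacent big descent fits on the left, so the pair
    -- could be exchanged. The hypothesis on `w` covers both `toℕ` and run weights.
    sorted⇒runsRise : (∀ p q → toℕ q ≡ suc (toℕ p) → Big m π q → w p < w q) →
      Sorted m w π → RunsRise π
    sorted⇒runsRise adjacent sorted p q q≡1+p bigp bigq = nondescent⇒rise π q≡1+p λ πq<πp →
      sorted p q bigq (adjacent p q q≡1+p bigq) πq<πp (chain-pred π m q≡1+p (<⇒≤ πq<πp) bigq)

    within-adjacent : RunWeight π w → ∀ p q → toℕ q ≡ suc (toℕ p) → Big m π q → w p < w q
    within-adjacent rw p q q≡1+p bigq = within rw p q (≤-reflexive (sym q≡1+p))
      λ r p<r r≤q → subst (Big m π)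
        (toℕ-injective (≤-antisym (subst (_≤ toℕ r) (sym q≡1+p) p<r) r≤q)) bigq

    -- The last two entries of the occurrence are big. If a small entry separates them, `across`
    -- allows their exchange; if none does, the descent lies inside a run, where entries rise.
    sorted⇒avoidsH : RunWeight π w → Sorted m w π → ¬ ContainsH (2 + m) π
    sorted⇒avoidsH rw sorted
      (ι , occ , a , b , a≡m , b≡1+m , j , (x , y , refl , y≡1+x , πy<πx) , ιa≤x , x<ιb)
      with ιa<ιb , πa<πb , bigιa ← J⇒chain m π occ a b a≡m b≡1+m = contradiction πy<πx (<-asym
        (sorted⇒runsRise (within-adjacent rw) sorted x y y≡1+x (big x ιa≤x (<⇒≤ x<ιb))
          (big y (≤-trans ιa≤x (≤-trans (n≤1+n _) (≤-reflexive (sym y≡1+x))))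
            (subst (_≤ toℕ (ι b)) (sym y≡1+x) x<ιb))))
      where
      bigιb : Big m π (ι b)
      bigιb = chain-mono π m (<⇒≤ ιa<ιb) (<⇒≤ πa<πb) bigιa
      big : ∀ r → toℕ (ι a) ≤ toℕ r → toℕ r ≤ toℕ (ι b) → Big m π r
      big r ιa≤r r≤ιb with m≤n⇒m<n∨m≡n ιa≤r | m≤n⇒m<n∨m≡n r≤ιb | big? m π r
      ... | _ | _ | yes bigr = bigr
      ... | inj₂ eq | _ | no small = subst (Big m π) (toℕ-injective eq) bigιa
      ... | _ | inj₂ eq | no small = subst (Big m π) (toℕ-injective (sym eq)) bigιb
      ... | inj₁ ιa<r | inj₁ r<ιb | no small = contradiction
        (chain-mono π m (<⇒≤ ιa<ιb) ≤-refl bigιa)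
        (sorted (ι b) (ι a) bigιa (across rw (ι a) (ι b) r ιa<r r<ιb small) πa<πb)

    -- Bigness propagates along the ascending stretch, so the last two entries lie in one run and
    -- are out of order there.
    sorted⇒avoidsQ : RunWeight π w → Sorted m w π → ¬ ContainsQ (2 + m) π
    sorted⇒avoidsQ rw sorted (ι , occ , a , b , a≡m , b≡1+m , rise , _)
      with ιa<ιb , πb<πa , c ← G⇒chain m π occ a b a≡m b≡1+m =
      sorted (ι a) (ι b) bigιb (within rw (ι a) (ι b) ιa<ιb big) πb<πa c
      where
      bigιb : Big m π (ι b)
      bigιb = chain-mono π m (<⇒≤ ιa<ιb) ≤-refl c
      big : ∀ r → toℕ (ι a) < toℕ r → toℕ r ≤ toℕ (ι b) → Big m π r
      big r ιa<r r≤ιb with m≤n⇒m<n∨m≡n r≤ιb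
      ... | inj₂ eq = subst (Big m π) (toℕ-injective (sym eq)) bigιb
      ... | inj₁ r<ιb = climb (λ s → toℕ s < toℕ (ι b) → Big m π s)
        (λ _ → chain-mono π m ≤-refl (<⇒≤ πb<πa) c)
        (λ s t ιa≤s t≡1+s ih t<ιb →
          let s<t = ≤-reflexive (sym t≡1+s) in
          chain-mono π m (<⇒≤ s<t) (<⇒≤ (rise s t ιa≤s t≡1+s t<ιb)) (ih (<-trans s<t t<ιb)))
        r (<⇒≤ ιa<r) r<ιb

    -- Consider an allowed exchange. If `p` precedes `q`, the weights force a single run, which
    -- rises by avoidance of Q_k. If `q` precedes `p`, avoidance of H_k excludes descents between
    -- them, so they share a run and `within` reverses the weights.
    avoidsHQ⇒sorted : RunWeight π w → AvoidsHQ (2 + m) π → Sorted m w π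
    avoidsHQ⇒sorted rw (avoidsH , avoidsQ) p q bigq wp<wq πq<πp c with <-cmp (toℕ p) (toℕ q)
    ... | tri≈ _ eq _ = <-irrefl (cong w (toℕ-injective eq)) wp<wq
    ... | tri< p<q _ _ = <⇒≱ πq<πp (runsRise-≤ π (avoidsQ⇒runsRise avoidsQ) p<q
        (chain-mono π m ≤-refl (<⇒≤ πq<πp) c) big)
      where
      big : ∀ r → toℕ p < toℕ r → toℕ r ≤ toℕ q → Big m π r
      big r p<r r≤q with m≤n⇒m<n∨m≡n r≤q | big? m π r
      ... | inj₂ eq | _ = subst (Big m π) (toℕ-injective (sym eq)) bigq
      ... | inj₁ _ | yes bigr = bigr
      ... | inj₁ r<q | no small = contradiction wp<wq (<-asym (across rw p q r p<r r<q small))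
    ... | tri> _ _ q<p
      with ι , occ , ι-q , ι-p ← chain⇒J m π q<p πq<πp bigq =
      <-asym wp<wq (within rw q p q<p λ r q<r → big r (<⇒≤ q<r))
      where
      no-descent : ∀ r s → toℕ q ≤ toℕ r → toℕ s ≡ suc (toℕ r) → toℕ s ≤ toℕ p → val π r ≤ val π s
      no-descent r s q≤r s≡1+r s≤p = ≮⇒≥ λ πs<πr → avoidsH
        (ι , occ , _ , _ , toℕ-penultimateIndex m , toℕ-lastIndex m , toℕ r ,
         (r , s , refl , s≡1+r , πs<πr) ,
         subst (λ x → toℕ x ≤ toℕ r) (sym (ι-q _ (toℕ-penultimateIndex m))) q≤r ,
         subst (λ x → toℕ r < toℕ x) (sym (ι-p _ (toℕ-lastIndex m))) (subst (_≤ toℕ p) s≡1+r s≤p))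
      big : ∀ r → toℕ q ≤ toℕ r → toℕ r ≤ toℕ p → Big m π r
      big = climb (λ r → toℕ r ≤ toℕ p → Big m π r) (λ _ → bigq) λ r s q≤r s≡1+r ih s≤p →
        let r≤s = <⇒≤ (≤-reflexive (sym s≡1+r)) in
        chain-mono π m r≤s (no-descent r s q≤r s≡1+r s≤p) (ih (≤-trans r≤s s≤p))

  -- For the weight `toℕ`, an allowed exchange is the end of an occurrence of `G` together with the
  -- chain below it.
  avoidsG⇒sorted : ∀ {π : Permutation′ n} → AvoidsG (2 + m) π → Sorted m toℕ π
  avoidsG⇒sorted {π} avoids p q _ p<q πq<πp c
    with ι , occ , _ ← chain⇒G m π p<q πq<πp c = avoids (ι , occ)

  sorted⇒avoidsG : ∀ {π : Permutation′ n} → Sorted m toℕ π → AvoidsG (2 + m) π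
  sorted⇒avoidsG {π} sorted (ι , occ)
    with ιa<ιb , πb<πa , c ← G⇒chain m π occ _ _ (toℕ-penultimateIndex m) (toℕ-lastIndex m) =
    sorted _ _ (chain-mono π m (<⇒≤ ιa<ιb) ≤-refl c) ιa<ιb πb<πa c

  -- Descents depend only on the small entries.

  descent-transfer : ∀ {π σ : Permutation′ n} → _~_ m π σ → RunsRise σ →
    ∀ {j} → Descent σ j → Descent π j
  descent-transfer {π} {σ} e rise (p , q , p≡j , q≡1+j , σq<σp)
    with q≡1+p ← trans q≡1+j (cong suc (sym p≡j))
    with big? m π p | big? m π q
  ... | yes bigp | yes bigq = contradiction σq<σp
    (<-asym (rise p q q≡1+p (to (_~_.bigs e p) bigp) (to (_~_.bigs e q) bigq)))
  ... | yes bigp | no smallq = p , q , p≡j , q≡1+j , big⇒small-descends π q≡1+p bigp smallq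
  ... | no smallp | yes bigq = contradiction σq<σp
    (<-asym (small⇒big-rises σ q≡1+p (smallp ∘ from (_~_.bigs e p)) (to (_~_.bigs e q) bigq)))
  ... | no smallp | no smallq = p , q , p≡j , q≡1+j ,
    subst₂ (λ x y → toℕ x < toℕ y) (sym (_~_.smalls e q smallq)) (sym (_~_.smalls e p smallp)) σq<σp

  -- Construction of an injective run weight.

  smallAfter : Permutation′ n → Fin n → Fin n → ℕ
  smallAfter π p s with toℕ p <? toℕ s | big? m π s
  ... | yes _ | no _ = 1
  ... | _ | _ = 0

  -- Lexicographic order, first by the number of small positions to the right and then by position,
  -- written in base `n` with the position as low digit.
  runWeight : Permutation′ n → Fin n → ℕ
  runWeight π p = toℕ p + ∑ (smallAfter π p) * n

  runWeight-injective : ∀ π → Injective _≡_ _≡_ (runWeight π)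
  runWeight-injective π {p} {q} eq = toℕ-injective (begin
    toℕ p              ≡⟨ remainder p ⟨
    runWeight π p % n  ≡⟨ cong (_% n) eq ⟩
    runWeight π q % n  ≡⟨ remainder q ⟩
    toℕ q              ∎)
    where
    open ≡-Reasoning
    instance _ = nonZeroIndex p
    remainder : ∀ r → runWeight π r % n ≡ toℕ r
    remainder r = trans ([m+kn]%n≡m%n (toℕ r) (∑ (smallAfter π r)) n) (m<n⇒m%n≡m (toℕ<n r))

  runWeight-correct : ∀ π → RunWeight π (runWeight π)
  runWeight-correct π = record { within = within′ ; across = across′ }
    where
    smallAfter-antitone : ∀ {p q} → toℕ p ≤ toℕ q → ∀ s → smallAfter π q s ≤ smallAfter π p s
    smallAfter-antitone {p} {q} p≤q s with toℕ q <? toℕ s | toℕ p <? toℕ s | big? m π s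
    ... | yes q<s | no p≮s | no _ = contradiction (≤-<-trans p≤q q<s) p≮s
    ... | yes _ | yes _ | no _ = ≤-refl
    ... | yes _ | _ | yes _ = z≤n
    ... | no _ | _ | _ = z≤n

    within′ : ∀ p q → toℕ p < toℕ q → (∀ r → toℕ p < toℕ r → toℕ r ≤ toℕ q → Big m π r) →
      runWeight π p < runWeight π q
    within′ p q p<q big = +-mono-<-≤ p<q (*-monoˡ-≤ n (∑-mono same))
      where
      same : ∀ s → smallAfter π p s ≤ smallAfter π q s
      same s with toℕ p <? toℕ s | toℕ q <? toℕ s | big? m π s
      ... | yes p<s | no q≮s | no small = contradiction (big s p<s (≮⇒≥ q≮s)) small
      ... | yes _ | yes _ | no _ = ≤-refl
      ... | yes _ | _ | yes _ = z≤n
      ... | no _ | _ | _ = z≤n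

    across′ : ∀ p q s → toℕ p < toℕ s → toℕ s < toℕ q → ¬ Big m π s → runWeight π q < runWeight π p
    across′ p q s p<s s<q small = begin-strict
      -- One more small position counts `n`, which outweighs any position.
      toℕ q + ∑ (smallAfter π q) * n  <⟨ +-monoˡ-< _ (toℕ<n q) ⟩
      suc (∑ (smallAfter π q)) * n    ≤⟨ *-monoˡ-≤ n fewer ⟩
      ∑ (smallAfter π p) * n          ≤⟨ m≤n+m _ (toℕ p) ⟩
      toℕ p + ∑ (smallAfter π p) * n  ∎
      where
      open ≤-Reasoning
      one : smallAfter π q s < smallAfter π p s
      one with toℕ q <? toℕ s | toℕ p <? toℕ s | big? m π s
      ... | yes q<s | _ | _ = contradiction q<s (<-asym s<q)
      ... | no _ | no p≮s | _ = contradiction p<s p≮s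
      ... | no _ | yes _ | yes big = contradiction big small
      ... | no _ | yes _ | no _ = ≤-refl
      fewer : ∑ (smallAfter π q) < ∑ (smallAfter π p)
      fewer = ∑-mono-< (smallAfter-antitone (<⇒≤ (<-trans p<s s<q))) s one

  -- The bijection.

  avoidsG-unique : ∀ {π σ : Permutation′ n} → _~_ m π σ →
    AvoidsG (2 + m) π → AvoidsG (2 + m) σ → π ≈ₚ σ
  avoidsG-unique π~σ aπ aσ =
    sorted-unique m toℕ toℕ-injective π~σ (avoidsG⇒sorted aπ) (avoidsG⇒sorted aσ)

  -- `π` and `σ` have the same big positions, so the run weight built from `π` serves for both.
  avoidsHQ-unique : ∀ {π σ : Permutation′ n} → _~_ m π σ →
    AvoidsHQ (2 + m) π → AvoidsHQ (2 + m) σ → π ≈ₚ σ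
  avoidsHQ-unique {π} π~σ aπ aσ =
    sorted-unique m (runWeight π) (runWeight-injective π) π~σ
      (avoidsHQ⇒sorted rw aπ) (avoidsHQ⇒sorted (runWeight-resp π~σ rw) aσ)
    where rw = runWeight-correct π

  toG : ∀ (σ : Permutation′ n) → ∃[ π ] (_~_ m σ π × AvoidsG (2 + m) π)
  toG σ with π , σ~π , sorted ← sort m toℕ σ = π , σ~π , sorted⇒avoidsG sorted

  toHQ : ∀ (π : Permutation′ n) → ∃[ σ ] (_~_ m π σ × AvoidsHQ (2 + m) σ)
  toHQ π with σ , π~σ , sorted ← sort m (runWeight π) π =
    σ , π~σ , sorted⇒avoidsH rw sorted , sorted⇒avoidsQ rw sorted
    where rw = runWeight-resp π~σ (runWeight-correct π)

theorem2 : (k n : ℕ) → 3 ≤ k → 1 ≤ n →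
    Σ ((π : Permutation′ n) → AvoidsG k π → Permutation′ n) λ f → DescentPreservingBijection k n f
theorem2 (suc zero) n (s≤s ())
theorem2 (suc (suc m)) n _ _ = (λ π _ → f π) , respects , (λ π _ → f-avoids π) , injective ,
  surjective , descents
  where
  k = 2 + m
  f : Permutation′ n → Permutation′ n
  f π = proj₁ (toHQ m π)
  f~ : ∀ π → _~_ m π (f π)
  f~ π = proj₁ (proj₂ (toHQ m π))
  f-avoids : ∀ π → AvoidsHQ k (f π)
  f-avoids π = proj₂ (proj₂ (toHQ m π))
  respects : ∀ π σ (a : AvoidsG k π) (b : AvoidsG k σ) → π ≈ₚ σ → f π ≈ₚ f σ
  -- Each class of `_~_` holds exactly one avoider of each kind up to `_≈ₚ_`, and `f` stays inside
  -- the class; the next two claims rest on this as well.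
  respects π σ _ _ π≈σ = avoidsHQ-unique m
    (~-trans m (~-sym m (f~ π)) (~-trans m (≈⇒~ m π≈σ) (f~ σ))) (f-avoids π) (f-avoids σ)
  injective : ∀ π σ (a : AvoidsG k π) (b : AvoidsG k σ) → f π ≈ₚ f σ → π ≈ₚ σ
  injective π σ a b fπ≈fσ = avoidsG-unique m
    (~-trans m (f~ π) (~-trans m (≈⇒~ m fπ≈fσ) (~-sym m (f~ σ)))) a b
  surjective : ∀ σ → AvoidsHQ k σ → ∃[ π ] Σ (AvoidsG k π) λ _ → f π ≈ₚ σ
  surjective σ a with π , σ~π , b ← toG m σ =
    π , b , avoidsHQ-unique m (~-sym m (~-trans m σ~π (f~ π))) (f-avoids π) a
  descents : ∀ π (a : AvoidsG k π) j → Descent (f π) j ⇔ Descent π j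
  descents π a j = mk⇔
    (descent-transfer m (f~ π) (avoidsQ⇒runsRise m (proj₂ (f-avoids π))))
    (descent-transfer m (~-sym m (f~ π)) (sorted⇒runsRise m
      (λ p q q≡1+p _ → ≤-reflexive (sym q≡1+p)) (avoidsG⇒sorted m a)))
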